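{- Let $q$ be a prime power, let $g\in\mathbb F_q[x]$ be a polynomial of degree $\delta>0$, let $t\ge1$ be an integer, and let $r_1,\dots,r_t>0$ be real numbers. For a positive integer $n$, let $\mathcal R_n(g,q;r_1,\dots,r_t)$ be the set of monic polynomials $f\in\mathbb F_q[x]$ of degree $n$ that admit a representation $$f=h+g^{\lfloor k_1^{r_1}\rfloor}+\cdots+g^{\lfloor k_t^{r_t}\rfloor},$$ where $h\in\mathbb F_q[x]$ is a monic irreducible polynomial of degree $n$ and $k_1,\dots,k_t$ are positive integers satisfying $\delta\lfloor k_i^{r_i}\rfloor<n$ for each $i$. Then there exists a monic irreducible polynomial $p\in\mathbb F_q[x]$ such that for every integer $n>\deg p$, if $f\in\mathbb F_q[x]$ is a monic polynomial of degree $n$ satisfying $f\equiv t\pmod p$, then $f\notin\mathcal R_n(g,q;r_1,\dots,r_t)$.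
   Context: $\mathbb F_q$ is the finite field with $q$ elements. In the congruence $f\equiv t\pmod p$, the integer $t$ is regarded as the constant polynomial $t\cdot 1\in\mathbb F_q\subset\mathbb F_q[x]$. The polynomial $g$ is not assumed to be monic. -}

module Defs where

open import Algebra.Apartness.Bundles using (HeytingCommutativeRing; HeytingField)
open import Algebra.Bundles using (CommutativeRing)
open import Algebra.Bundles.Raw using (RawRing)
import Algebra.Definitions.RawMonoid as RawMonoidDefs
import Algebra.Definitions.RawSemiring as RawSemiringDefs
import Algebra.Properties.CommutativeSemiring.Exp as Exp
open import Data.Integer.Base as ℤ using (+_; -[1+_])
import Data.Integer.Properties as ℤ
open import Data.List.Base using (List; []; _∷_; map)
open import Data.Nat.Base as ℕ using (ℕ; zero; suc; z≤n; s≤s)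
import Data.Nat.Properties as ℕ
open import Data.Nat.Primality using (Prime)
open import Data.Product.Base using (∃; ∃₂; ∃-syntax; _×_; _,_)
open import Data.Rational.Base as ℚ using (ℚ; mkℚ; 0ℚ; 1ℚ; _/_)
import Data.Rational.Properties as ℚ
import Data.Rational.Unnormalised.Base as ℚᵘ
import Data.Rational.Unnormalised.Properties as ℚᵘ
open import Data.Sum.Base using (_⊎_; inj₁; inj₂)
open import Data.Vec.Functional using (Vector)
open import Level using (_⊔_; 0ℓ)
open import Relation.Binary.Definitions using (tri<; tri≈; tri>)
open import Relation.Binary.PropositionalEquality
  using (_≡_; refl; sym; trans; cong; subst; subst₂)
open import Relation.Nullary using (¬_; yes; no; contradiction)
open import Relation.Unary using (Pred)

PrimePower : ℕ → Set
PrimePower q = ∃₂ λ ℓ e → Prime ℓ × 0 ℕ.< e × q ≡ ℓ ℕ.^ e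

-- Real numbers are two-sided, located Dedekind cuts of ℚ.

record ℝ : Set₁ where
  field
    L U         : Pred ℚ 0ℓ
    L-inhabited : ∃ L
    U-inhabited : ∃ U
    L-lower     : ∀ {p q} → p ℚ.< q → L q → L p
    U-upper     : ∀ {p q} → p ℚ.< q → U p → U q
    L-open      : ∀ {p} → L p → ∃[ q ] p ℚ.< q × L q
    U-open      : ∀ {q} → U q → ∃[ p ] p ℚ.< q × U p
    disjoint    : ∀ {q} → L q → ¬ U q
    located     : ∀ {p q} → p ℚ.< q → L p ⊎ U q

infix 4 _<ℝ_ _≤ℝ_

_<ℝ_ : ℝ → ℝ → Set
x <ℝ y = ∃[ q ] ℝ.U x q × ℝ.L y q

_≤ℝ_ : ℝ → ℝ → Set
x ≤ℝ y = ∀ {q} → ℝ.L x q → ℝ.L y q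

fromℚ : ℚ → ℝ
fromℚ x = record
  { L           = λ p → p ℚ.< x
  ; U           = λ p → x ℚ.< p
  ; L-inhabited = x ℚ.- 1ℚ , subst (x ℚ.- 1ℚ ℚ.<_) (ℚ.+-identityʳ x)
                    (ℚ.+-monoʳ-< x (ℚ.negative⁻¹ (ℚ.- 1ℚ)))
  ; U-inhabited = x ℚ.+ 1ℚ , subst (ℚ._< x ℚ.+ 1ℚ) (ℚ.+-identityʳ x)
                    (ℚ.+-monoʳ-< x (ℚ.positive⁻¹ 1ℚ))
  ; L-lower     = ℚ.<-trans
  ; U-upper     = λ p<q x<p → ℚ.<-trans x<p p<q
  ; L-open      = ℚ.<-dense
  ; U-open      = λ x<q → let p , x<p , p<q = ℚ.<-dense x<q in p , p<q , x<p
  ; disjoint    = ℚ.<-asym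
  ; located     = locate
  }
  where
  locate : ∀ {p q} → p ℚ.< q → p ℚ.< x ⊎ x ℚ.< q
  locate {p} p<q with p ℚ.<? x
  ... | yes p<x = inj₁ p<x
  ... | no  p≮x = inj₂ (ℚ.≤-<-trans (ℚ.≮⇒≥ p≮x) p<q)

fromℕ : ℕ → ℝ
fromℕ n = fromℚ (+ n / 1)

0ℝ : ℝ
0ℝ = fromℕ 0

-- The floor function on ℝ is not constructively definable, so it is given by
-- its graph: IsFloor x m says ⌊ x ⌋ = m.  Natural values suffice for x ≥ 0.

IsFloor : ℝ → ℕ → Set
IsFloor x m = fromℕ m ≤ℝ x × x <ℝ fromℕ (suc m)

module RealPower where

  open RawSemiringDefs ℚ.+-*-rawSemiring using (_^_)
  open Exp (CommutativeRing.commutativeSemiring ℚ.+-*-commutativeRing)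
    using (^-distrib-*)
  open import Algebra.Properties.Semiring.Exp
    (CommutativeRing.semiring ℚ.+-*-commutativeRing) using (^-homo-*; ^-assocʳ)

  private

    0<1 : 0ℚ ℚ.< 1ℚ
    0<1 = ℚ.positive⁻¹ 1ℚ

    *-monoʳ-≤ : ∀ {p q r} → 0ℚ ℚ.≤ r → p ℚ.≤ q → p ℚ.* r ℚ.≤ q ℚ.* r
    *-monoʳ-≤ {r = r} 0≤r = ℚ.*-monoʳ-≤-nonNeg r {{ℚ.nonNegative 0≤r}}

    *-monoˡ-≤ : ∀ {p q r} → 0ℚ ℚ.≤ r → p ℚ.≤ q → r ℚ.* p ℚ.≤ r ℚ.* q
    *-monoˡ-≤ {r = r} 0≤r = ℚ.*-monoˡ-≤-nonNeg r {{ℚ.nonNegative 0≤r}}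

    *-monoʳ-< : ∀ {p q r} → 0ℚ ℚ.< r → p ℚ.< q → p ℚ.* r ℚ.< q ℚ.* r
    *-monoʳ-< {r = r} 0<r = ℚ.*-monoˡ-<-pos r {{ℚ.positive 0<r}}

    *-monoˡ-< : ∀ {p q r} → 0ℚ ℚ.< r → p ℚ.< q → r ℚ.* p ℚ.< r ℚ.* q
    *-monoˡ-< {r = r} 0<r = ℚ.*-monoʳ-<-pos r {{ℚ.positive 0<r}}

    *-nonNeg : ∀ {p q} → 0ℚ ℚ.≤ p → 0ℚ ℚ.≤ q → 0ℚ ℚ.≤ p ℚ.* q
    *-nonNeg {p} {q} 0≤p 0≤q =
      subst (ℚ._≤ p ℚ.* q) (ℚ.*-zeroˡ q) (*-monoʳ-≤ 0≤q 0≤p)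

    *-pos : ∀ {p q} → 0ℚ ℚ.< p → 0ℚ ℚ.< q → 0ℚ ℚ.< p ℚ.* q
    *-pos {p} {q} 0<p 0<q =
      subst (ℚ._< p ℚ.* q) (ℚ.*-zeroˡ q) (*-monoʳ-< 0<q 0<p)

    ^-nonNeg : ∀ {x} n → 0ℚ ℚ.≤ x → 0ℚ ℚ.≤ x ^ n
    ^-nonNeg zero    _   = ℚ.<⇒≤ 0<1
    ^-nonNeg (suc n) 0≤x = *-nonNeg 0≤x (^-nonNeg n 0≤x)

    ^-pos : ∀ {x} n → 0ℚ ℚ.< x → 0ℚ ℚ.< x ^ n
    ^-pos zero    _   = 0<1
    ^-pos (suc n) 0<x = *-pos 0<x (^-pos n 0<x)

    ^-monoˡ-≤ : ∀ {x y} n → 0ℚ ℚ.≤ x → x ℚ.≤ y → x ^ n ℚ.≤ y ^ n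
    ^-monoˡ-≤ zero    _   _   = ℚ.≤-refl
    ^-monoˡ-≤ (suc n) 0≤x x≤y = ℚ.≤-trans
      (*-monoʳ-≤ (^-nonNeg n 0≤x) x≤y)
      (*-monoˡ-≤ (ℚ.≤-trans 0≤x x≤y) (^-monoˡ-≤ n 0≤x x≤y))

    ^-monoˡ-< : ∀ {x y} n → 0ℚ ℚ.≤ x → x ℚ.< y → x ^ suc n ℚ.< y ^ suc n
    ^-monoˡ-< n 0≤x x<y = ℚ.≤-<-trans
      (*-monoˡ-≤ 0≤x (^-monoˡ-≤ n 0≤x (ℚ.<⇒≤ x<y)))
      (*-monoʳ-< (^-pos n (ℚ.≤-<-trans 0≤x x<y)) x<y)

    1≤^ : ∀ {x} n → 1ℚ ℚ.≤ x → 1ℚ ℚ.≤ x ^ n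
    1≤^ zero    _   = ℚ.≤-refl
    1≤^ {x} (suc n) 1≤x = ℚ.≤-trans 1≤x (subst (ℚ._≤ x ^ suc n) (ℚ.*-identityʳ x)
      (*-monoˡ-≤ (ℚ.≤-trans (ℚ.<⇒≤ 0<1) 1≤x) (1≤^ n 1≤x)))

    ^-monoʳ-≤ : ∀ {x m n} → 1ℚ ℚ.≤ x → m ℕ.≤ n → x ^ m ℚ.≤ x ^ n
    ^-monoʳ-≤ {n = n} 1≤x z≤n       = 1≤^ n 1≤x
    ^-monoʳ-≤         1≤x (s≤s m≤n) =
      *-monoˡ-≤ (ℚ.≤-trans (ℚ.<⇒≤ 0<1) 1≤x) (^-monoʳ-≤ 1≤x m≤n)

    x≤x^[1+n] : ∀ {x} n → 1ℚ ℚ.≤ x → x ℚ.≤ x ^ suc n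
    x≤x^[1+n] {x} n 1≤x = subst (ℚ._≤ x ^ suc n) (ℚ.*-identityʳ x)
      (^-monoʳ-≤ {x} {1} {suc n} 1≤x (s≤s z≤n))

    p<p+1 : ∀ p → p ℚ.< p ℚ.+ 1ℚ
    p<p+1 p = subst (ℚ._< p ℚ.+ 1ℚ) (ℚ.+-identityʳ p) (ℚ.+-monoʳ-< p 0<1)

    -- Quotients z / v of positive rationals, packaged with their defining law.
    divide : ∀ z {v} → 0ℚ ℚ.< v → ∃[ u ] u ℚ.* v ≡ z
    divide z {v} 0<v = z ℚ.* 1/v , trans (ℚ.*-assoc z 1/v v)
      (trans (cong (z ℚ.*_) (ℚ.*-inverseˡ v {{v≢0}})) (ℚ.*-identityʳ z))
      where
      v≢0 = ℚ.>-nonZero 0<v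
      1/v = ℚ.1/_ v {{v≢0}}

    *-cancelʳ-< : ∀ {p q r} → 0ℚ ℚ.< r → p ℚ.* r ℚ.< q ℚ.* r → p ℚ.< q
    *-cancelʳ-< {r = r} 0<r = ℚ.*-cancelʳ-<-nonNeg r {{ℚ.nonNegative (ℚ.<⇒≤ 0<r)}}

    *-bump : ∀ {u v y} → 0ℚ ℚ.≤ v → u ℚ.* v ℚ.< y → ∃[ w ] u ℚ.< w × w ℚ.* v ℚ.< y
    *-bump {u} {v} {y} 0≤v uv<y with 0ℚ ℚ.<? v
    ... | yes 0<v =
      let z , uv<z , z<y = ℚ.<-dense uv<y
          w , wv≡z       = divide z 0<v
      in w , *-cancelʳ-< 0<v (subst (u ℚ.* v ℚ.<_) (sym wv≡z) uv<z)
           , subst (ℚ._< y) (sym wv≡z) z<y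
    ... | no 0≮v = u ℚ.+ 1ℚ , p<p+1 u
        , subst (ℚ._< y) (trans (vanish u) (sym (vanish (u ℚ.+ 1ℚ)))) uv<y
      where
      vanish : ∀ x → x ℚ.* v ≡ 0ℚ
      vanish x = trans (cong (x ℚ.*_) (ℚ.≤-antisym (ℚ.≮⇒≥ 0≮v) 0≤v)) (ℚ.*-zeroʳ x)

    *-dip : ∀ {u v x} → 0ℚ ℚ.≤ x → 0ℚ ℚ.< v → x ℚ.< u ℚ.* v →
            ∃[ w ] w ℚ.< u × x ℚ.< w ℚ.* v
    *-dip {u} {v} {x} 0≤x 0<v x<uv =
      let z , x<z , z<uv = ℚ.<-dense x<uv
          w , wv≡z       = divide z 0<v
      in w , *-cancelʳ-< 0<v (subst (ℚ._< u ℚ.* v) (sym wv≡z) z<uv)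
           , subst (x ℚ.<_) (sym wv≡z) x<z

    ^-bump : ∀ {x y} n → 0ℚ ℚ.≤ x → x ^ n ℚ.< y → ∃[ w ] x ℚ.< w × w ^ n ℚ.< y
    ^-bump {x} zero    0≤x 1<y  = x ℚ.+ 1ℚ , p<p+1 x , 1<y
    ^-bump {x} {y} (suc n) 0≤x xxⁿ<y =
      let u , x<u , uxⁿ<y = *-bump (^-nonNeg n 0≤x) xxⁿ<y
          0≤u             = ℚ.≤-trans 0≤x (ℚ.<⇒≤ x<u)
          v , xⁿ<v , vu<y = *-bump 0≤u (subst (ℚ._< y) (ℚ.*-comm u (x ^ n)) uxⁿ<y)
          w , x<w , wⁿ<v  = ^-bump n 0≤x xⁿ<v
      in least u w x<u x<w 0≤u (ℚ.<⇒≤ wⁿ<v) (subst (ℚ._< y) (ℚ.*-comm v u) vu<y)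
      where
      least : ∀ u w {v} → x ℚ.< u → x ℚ.< w → 0ℚ ℚ.≤ u → w ^ n ℚ.≤ v → u ℚ.* v ℚ.< y →
              ∃[ w ] x ℚ.< w × w ^ suc n ℚ.< y
      least u w x<u x<w 0≤u wⁿ≤v uv<y with ℚ.≤-total u w
      ... | inj₁ u≤w = u , x<u , ℚ.≤-<-trans
              (*-monoˡ-≤ 0≤u (ℚ.≤-trans (^-monoˡ-≤ n 0≤u u≤w) wⁿ≤v)) uv<y
      ... | inj₂ w≤u = w , x<w , ℚ.≤-<-trans
              (ℚ.≤-trans (*-monoʳ-≤ (^-nonNeg n 0≤w) w≤u) (*-monoˡ-≤ 0≤u wⁿ≤v)) uv<y
        where 0≤w = ℚ.≤-trans 0≤x (ℚ.<⇒≤ x<w)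

    ^-dip : ∀ {x y} n → 0ℚ ℚ.≤ y → 0ℚ ℚ.< x → y ℚ.< x ^ n →
            ∃[ w ] w ℚ.< x × 0ℚ ℚ.< w × y ℚ.< w ^ n
    ^-dip zero 0≤y 0<x y<1 =
      let w , 0<w , w<x = ℚ.<-dense 0<x in w , w<x , 0<w , y<1
    ^-dip {x} {y} (suc n) 0≤y 0<x y<xxⁿ =
      let u , u<x , y<uxⁿ  = *-dip 0≤y (^-pos n 0<x) y<xxⁿ
          0<u              = *-cancelʳ-< (^-pos n 0<x)
                               (subst (ℚ._< u ℚ.* x ^ n) (sym (ℚ.*-zeroˡ (x ^ n)))
                                 (ℚ.≤-<-trans 0≤y y<uxⁿ))
          v , v<xⁿ , y<vu  = *-dip 0≤y 0<u
                               (subst (y ℚ.<_) (ℚ.*-comm u (x ^ n)) y<uxⁿ)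
          0<v              = *-cancelʳ-< 0<u
                               (subst (ℚ._< v ℚ.* u) (sym (ℚ.*-zeroˡ u))
                                 (ℚ.≤-<-trans 0≤y y<vu))
          w , w<x , 0<w , v<wⁿ = ^-dip n (ℚ.<⇒≤ 0<v) 0<x v<xⁿ
      in greatest u w u<x w<x 0<u 0<w (ℚ.<⇒≤ v<wⁿ) (subst (y ℚ.<_) (ℚ.*-comm v u) y<vu)
      where
      greatest : ∀ u w {v} → u ℚ.< x → w ℚ.< x → 0ℚ ℚ.< u → 0ℚ ℚ.< w →
                 v ℚ.≤ w ^ n → y ℚ.< u ℚ.* v → ∃[ w ] w ℚ.< x × 0ℚ ℚ.< w × y ℚ.< w ^ suc n
      greatest u w u<x w<x 0<u 0<w v≤wⁿ y<uv with ℚ.≤-total u w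
      ... | inj₁ u≤w = w , w<x , 0<w , ℚ.<-≤-trans y<uv
              (ℚ.≤-trans (*-monoˡ-≤ (ℚ.<⇒≤ 0<u) v≤wⁿ)
                         (*-monoʳ-≤ (^-nonNeg n (ℚ.<⇒≤ 0<w)) u≤w))
      ... | inj₂ w≤u = u , u<x , 0<u , ℚ.<-≤-trans y<uv
              (*-monoˡ-≤ (ℚ.<⇒≤ 0<u) (ℚ.≤-trans v≤wⁿ (^-monoˡ-≤ n (ℚ.<⇒≤ 0<w) w≤u)))

    /-cancel-< : ∀ {a b c d} → + a / suc b ℚ.< + c / suc d → a ℕ.* suc d ℕ.< c ℕ.* suc b
    /-cancel-< {a} {b} {c} {d} lt = ℤ.drop‿+<+
      (subst₂ ℤ._<_ (sym (ℤ.pos-* a (suc d))) (sym (ℤ.pos-* c (suc b)))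
        (ℚᵘ.drop-*<*
          (ℚᵘ.<-respˡ-≃ (ℚ.toℚᵘ-fromℚᵘ (ℚᵘ.mkℚᵘ (+ a) b))
            (ℚᵘ.<-respʳ-≃ (ℚ.toℚᵘ-fromℚᵘ (ℚᵘ.mkℚᵘ (+ c) d)) (ℚ.toℚᵘ-mono-< lt)))))

    /-mono-< : ∀ {a b c d} → a ℕ.* suc d ℕ.< c ℕ.* suc b → + a / suc b ℚ.< + c / suc d
    /-mono-< {a} {b} {c} {d} lt = ℚ.toℚᵘ-cancel-<
      (ℚᵘ.<-respˡ-≃ (ℚᵘ.≃-sym (ℚ.toℚᵘ-fromℚᵘ (ℚᵘ.mkℚᵘ (+ a) b)))
        (ℚᵘ.<-respʳ-≃ (ℚᵘ.≃-sym (ℚ.toℚᵘ-fromℚᵘ (ℚᵘ.mkℚᵘ (+ c) d)))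
          (ℚᵘ.*<* (subst₂ ℤ._<_ (ℤ.pos-* a (suc d)) (ℤ.pos-* c (suc b)) (ℤ.+<+ lt)))))

    1≤k/1 : ∀ k .{{_ : ℕ.NonZero k}} → 1ℚ ℚ.≤ + k / 1
    1≤k/1 (suc zero)    = ℚ.≤-refl
    1≤k/1 (suc (suc k)) = ℚ.<⇒≤ (/-mono-< {1} {0} {suc (suc k)} {0} (s≤s (s≤s z≤n)))

    archimedean : ∀ p → ∃[ n ] p ℚ.< + n / 1
    archimedean p@(mkℚ (+ n) d _) = suc n ,
      subst (ℚ._< + suc n / 1) (ℚ.↥p/↧p≡p p)
        (/-mono-< {n} {d} {suc n} {0} (subst (ℕ._< suc n ℕ.* suc d) (sym (ℕ.*-identityʳ n))
          (ℕ.m≤m*n (suc n) (suc d))))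
    archimedean p@(mkℚ (-[1+ _ ]) _ _) = 0 , ℚ.negative⁻¹ p

    suc/1 : ∀ n → + suc n / 1 ≡ 1ℚ ℚ.+ + n / 1
    suc/1 n = ℚ.toℚᵘ-injective (ℚᵘ.≃-trans (ℚ.toℚᵘ-fromℚᵘ (ℚᵘ.mkℚᵘ (+ suc n) 0))
      (ℚᵘ.≃-trans (ℚᵘ.*≡* (cong (ℤ._* + 1) (cong (λ m → + 1 ℤ.+ m) (sym (ℤ.*-identityʳ (+ n))))))
      (ℚᵘ.≃-sym (ℚᵘ.≃-trans (ℚ.toℚᵘ-homo-+ 1ℚ (+ n / 1))
        (ℚᵘ.+-congʳ (ℚ.toℚᵘ 1ℚ) (ℚ.toℚᵘ-fromℚᵘ (ℚᵘ.mkℚᵘ (+ n) 0)))))))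

    bernoulli : ∀ {e} n → 0ℚ ℚ.≤ e → 1ℚ ℚ.+ (+ n / 1) ℚ.* e ℚ.≤ (1ℚ ℚ.+ e) ^ n
    bernoulli {e} zero 0≤e = ℚ.≤-reflexive
      (trans (cong (1ℚ ℚ.+_) (ℚ.*-zeroˡ e)) (ℚ.+-identityʳ 1ℚ))
    bernoulli {e} (suc n) 0≤e = ℚ.≤-trans step
      (*-monoˡ-≤ (ℚ.≤-trans 0≤e e≤1+e) (bernoulli n 0≤e))
      where
      open ℚ.≤-Reasoning
      ν = + n / 1
      0≤ν : 0ℚ ℚ.≤ ν
      0≤ν = ℚ.nonNegative⁻¹ ν {{ℚ.normalize-nonNeg n 1}}
      e≤1+e : e ℚ.≤ 1ℚ ℚ.+ e
      e≤1+e = subst (ℚ._≤ 1ℚ ℚ.+ e) (ℚ.+-identityˡ e) (ℚ.+-monoˡ-≤ e (ℚ.<⇒≤ 0<1))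
      A = 1ℚ ℚ.+ ν ℚ.* e
      step : 1ℚ ℚ.+ (+ suc n / 1) ℚ.* e ℚ.≤ (1ℚ ℚ.+ e) ℚ.* A
      step = begin
        1ℚ ℚ.+ (+ suc n / 1) ℚ.* e
          ≡⟨ cong (λ z → 1ℚ ℚ.+ z ℚ.* e) (suc/1 n) ⟩
        1ℚ ℚ.+ (1ℚ ℚ.+ ν) ℚ.* e
          ≡⟨ cong (1ℚ ℚ.+_) (trans (ℚ.*-distribʳ-+ e 1ℚ ν)
               (trans (cong (ℚ._+ ν ℚ.* e) (ℚ.*-identityˡ e)) (ℚ.+-comm e (ν ℚ.* e)))) ⟩
        1ℚ ℚ.+ (ν ℚ.* e ℚ.+ e)
          ≡⟨ ℚ.+-assoc 1ℚ (ν ℚ.* e) e ⟨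
        A ℚ.+ e
          ≡⟨ cong (A ℚ.+_) (ℚ.*-identityʳ e) ⟨
        A ℚ.+ e ℚ.* 1ℚ
          ≤⟨ ℚ.+-monoʳ-≤ A (*-monoˡ-≤ 0≤e 1≤A) ⟩
        A ℚ.+ e ℚ.* A
          ≡⟨ cong (ℚ._+ e ℚ.* A) (ℚ.*-identityˡ A) ⟨
        1ℚ ℚ.* A ℚ.+ e ℚ.* A
          ≡⟨ ℚ.*-distribʳ-+ A 1ℚ e ⟨
        (1ℚ ℚ.+ e) ℚ.* A ∎
        where
        1≤A : 1ℚ ℚ.≤ A
        1≤A = subst (ℚ._≤ A) (ℚ.+-identityʳ 1ℚ) (ℚ.+-monoʳ-≤ 1ℚ (*-nonNeg 0≤ν 0≤e))

    -- The powers of ρ > 1 are unbounded.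
    unbounded : ∀ {ρ} y → 1ℚ ℚ.< ρ → ∃[ n ] y ℚ.< ρ ^ suc n
    unbounded {ρ} y 1<ρ =
      let c , ce≡y = divide y 0<e
          n , c<n  = archimedean c
          y<ne     = subst (ℚ._< (+ n / 1) ℚ.* e) ce≡y (*-monoʳ-< 0<e c<n)
          ne≤1+ne  = subst (ℚ._≤ 1ℚ ℚ.+ (+ n / 1) ℚ.* e) (ℚ.+-identityˡ _)
                       (ℚ.+-monoˡ-≤ ((+ n / 1) ℚ.* e) (ℚ.<⇒≤ 0<1))
          y<ρⁿ     = ℚ.<-≤-trans y<ne (ℚ.≤-trans ne≤1+ne
                       (subst (λ z → 1ℚ ℚ.+ (+ n / 1) ℚ.* e ℚ.≤ z ^ n) 1+e≡ρ
                         (bernoulli n (ℚ.<⇒≤ 0<e))))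
      in n , ℚ.<-≤-trans y<ρⁿ (^-monoʳ-≤ (ℚ.<⇒≤ 1<ρ) (ℕ.n≤1+n n))
      where
      e = ρ ℚ.- 1ℚ
      0<e : 0ℚ ℚ.< e
      0<e = subst (ℚ._< e) (ℚ.+-inverseʳ 1ℚ) (ℚ.+-monoˡ-< (ℚ.- 1ℚ) 1<ρ)
      1+e≡ρ : 1ℚ ℚ.+ e ≡ ρ
      1+e≡ρ = trans (ℚ.+-comm 1ℚ e) (trans (ℚ.+-assoc ρ (ℚ.- 1ℚ) 1ℚ)
        (trans (cong (ρ ℚ.+_) (ℚ.+-inverseˡ 1ℚ)) (ℚ.+-identityʳ ρ)))

  -- For K ≥ 1 and r > 0, the real K^r is the cut determined by K^(a/b) < K^r for
  -- rationals 0 ≤ a/b < r and K^r < K^(a/b) for rationals r < a/b.  For q ≥ 0,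
  -- comparing q with K^(a/b) is comparing q^b with K^a; denominators are suc b.
  module _ (K : ℚ) (1≤K : 1ℚ ℚ.≤ K) (r : ℝ) (0<r : 0ℝ <ℝ r) where

    private
      module r = ℝ r

      0<K : 0ℚ ℚ.< K
      0<K = ℚ.<-≤-trans 0<1 1≤K

      0∈L : r.L 0ℚ
      0∈L = let _ , 0<q , q∈L = 0<r in r.L-lower 0<q q∈L

    Lower : Pred ℚ 0ℓ
    Lower q = q ℚ.< 0ℚ ⊎ (∃₂ λ a b → r.L (+ a / suc b) × q ^ suc b ℚ.< K ^ a)

    Upper : Pred ℚ 0ℓ
    Upper q = 0ℚ ℚ.< q × (∃₂ λ a b → r.U (+ a / suc b) × K ^ a ℚ.< q ^ suc b)

    private

      upper-inhabited : ∃ Upper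
      upper-inhabited with r.U-inhabited
      ... | c@(mkℚ (+ n) d _) , c∈U =
        K ^ n ℚ.+ 1ℚ , ℚ.<-trans (^-pos n 0<K) (p<p+1 (K ^ n)) , n , d ,
        subst r.U (sym (ℚ.↥p/↧p≡p c)) c∈U ,
        ℚ.<-≤-trans (p<p+1 (K ^ n)) (x≤x^[1+n] d
          (ℚ.≤-trans (1≤^ n 1≤K) (ℚ.<⇒≤ (p<p+1 (K ^ n)))))
      ... | c@(mkℚ (-[1+ _ ]) _ _) , c∈U =
        contradiction (r.U-upper (ℚ.negative⁻¹ c) c∈U) (r.disjoint 0∈L)

      lower-lower : ∀ {p q} → p ℚ.< q → Lower q → Lower p
      lower-lower p<q (inj₁ q<0) = inj₁ (ℚ.<-trans p<q q<0)
      lower-lower {p} p<q (inj₂ (a , b , ab∈L , qᵇ<Kᵃ)) with p ℚ.<? 0ℚ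
      ... | yes p<0 = inj₁ p<0
      ... | no  p≮0 = inj₂ (a , b , ab∈L ,
                        ℚ.<-trans (^-monoˡ-< b (ℚ.≮⇒≥ p≮0) p<q) qᵇ<Kᵃ)

      upper-upper : ∀ {p q} → p ℚ.< q → Upper p → Upper q
      upper-upper p<q (0<p , a , b , ab∈U , Kᵃ<pᵇ) =
        ℚ.<-trans 0<p p<q , a , b , ab∈U ,
        ℚ.<-trans Kᵃ<pᵇ (^-monoˡ-< b (ℚ.<⇒≤ 0<p) p<q)

      lower-open : ∀ {p} → Lower p → ∃[ q ] p ℚ.< q × Lower q
      lower-open {p} p∈L with p ℚ.<? 0ℚ | p∈L
      ... | yes p<0 | _ =
        let q , p<q , q<0 = ℚ.<-dense p<0 in q , p<q , inj₁ q<0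
      ... | no p≮0 | inj₁ p<0 = contradiction p<0 p≮0
      ... | no p≮0 | inj₂ (a , b , ab∈L , pᵇ<Kᵃ) =
        let q , p<q , qᵇ<Kᵃ = ^-bump (suc b) (ℚ.≮⇒≥ p≮0) pᵇ<Kᵃ
        in q , p<q , inj₂ (a , b , ab∈L , qᵇ<Kᵃ)

      upper-open : ∀ {q} → Upper q → ∃[ p ] p ℚ.< q × Upper p
      upper-open (0<q , a , b , ab∈U , Kᵃ<qᵇ) =
        let p , p<q , 0<p , Kᵃ<pᵇ = ^-dip (suc b) (^-nonNeg a (ℚ.<⇒≤ 0<K)) 0<q Kᵃ<qᵇ
        in p , p<q , 0<p , a , b , ab∈U , Kᵃ<pᵇ

      L<U : ∀ {p q} → r.L p → r.U q → p ℚ.< q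
      L<U {p} {q} p∈L q∈U with ℚ.<-cmp p q
      ... | tri< p<q _ _ = p<q
      ... | tri≈ _ refl _ = contradiction q∈U (r.disjoint p∈L)
      ... | tri> _ _ q<p =
        contradiction (r.U-upper q<p q∈U) (r.disjoint p∈L)

      not-both : ∀ {q} → Lower q → ¬ Upper q
      not-both (inj₁ q<0) (0<q , _) = ℚ.<-asym q<0 0<q
      not-both {q} (inj₂ (a , b , ab∈L , qᵇ<Kᵃ)) (0<q , c , d , cd∈U , Kᶜ<qᵈ) =
        ℚ.<-irrefl refl (begin-strict
          q ^ (suc b ℕ.* suc d)  ≡⟨ ^-assocʳ q (suc b) (suc d) ⟨
          (q ^ suc b) ^ suc d    <⟨ ^-monoˡ-< d (^-nonNeg (suc b) (ℚ.<⇒≤ 0<q)) qᵇ<Kᵃ ⟩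
          (K ^ a) ^ suc d        ≡⟨ ^-assocʳ K a (suc d) ⟩
          K ^ (a ℕ.* suc d)      ≤⟨ ^-monoʳ-≤ 1≤K (ℕ.<⇒≤ (/-cancel-< {a} {b} {c} {d}
                                      (L<U ab∈L cd∈U))) ⟩
          K ^ (c ℕ.* suc b)      ≡⟨ ^-assocʳ K c (suc b) ⟨
          (K ^ c) ^ suc b        <⟨ ^-monoˡ-< b (^-nonNeg c (ℚ.<⇒≤ 0<K)) Kᶜ<qᵈ ⟩
          (q ^ suc d) ^ suc b    ≡⟨ ^-assocʳ q (suc d) (suc b) ⟩
          q ^ (suc d ℕ.* suc b)  ≡⟨ cong (q ^_) (ℕ.*-comm (suc d) (suc b)) ⟩
          q ^ (suc b ℕ.* suc d)  ∎)
        where open ℚ.≤-Reasoning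

      -- Multiples of 1/(1+n) enclosing r up to 2/(1+n).
      enclose : ∀ n → ∃[ a ] r.L (+ a / suc n) × r.U (+ (2 ℕ.+ a) / suc n)
      enclose n = let c , c∈U = r.U-inhabited ; B , c<B = archimedean c in
        search B 0 (r.U-upper c<B c∈U) (subst r.L (sym 0/≡0) 0∈L)
        where
        0/≡0 : + 0 / suc n ≡ 0ℚ
        0/≡0 = ℚ.0/n≡0 (suc n)

        search : ∀ B a → r.U (+ B / 1) → r.L (+ a / suc n) →
                 ∃[ a ] r.L (+ a / suc n) × r.U (+ (2 ℕ.+ a) / suc n)
        search B a B∈U a∈L = go (B ℕ.* suc n) a (ℕ.m≤m+n _ a) a∈L
          where
          go : ∀ fuel a → B ℕ.* suc n ℕ.≤ fuel ℕ.+ a → r.L (+ a / suc n) →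
               ∃[ a ] r.L (+ a / suc n) × r.U (+ (2 ℕ.+ a) / suc n)
          go zero a Bn≤a a∈L = contradiction
            (ℕ.<-≤-trans (/-cancel-< {a} {n} {B} {0} (L<U a∈L B∈U)) Bn≤a)
            (ℕ.≤⇒≯ (ℕ.≤-reflexive (sym (ℕ.*-identityʳ a))))
          go (suc fuel) a Bn≤ a∈L
            with r.located (/-mono-< {suc a} {n} {2 ℕ.+ a} {n}
                   (ℕ.*-monoˡ-< (suc n) (ℕ.n<1+n (suc a))))
          ... | inj₂ a+2∈U = a , a∈L , a+2∈U
          ... | inj₁ a+1∈L =
            go fuel (suc a) (subst (B ℕ.* suc n ℕ.≤_) (sym (ℕ.+-suc fuel a)) Bn≤) a+1∈L

      compare : ∀ {p q ρ} → 0ℚ ℚ.< p → p ℚ.< q → 1ℚ ℚ.< ρ → ρ ℚ.* p ≡ q →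
                ∃[ n ] K ^ 2 ℚ.< ρ ^ suc n → Lower p ⊎ Upper q
      compare {p} {q} {ρ} 0<p p<q 1<ρ ρp≡q (n , K²<ρⁿ) = decide (enclose n)
        where
        open ℚ.≤-Reasoning

        decide : ∃[ a ] r.L (+ a / suc n) × r.U (+ (2 ℕ.+ a) / suc n) →
                 Lower p ⊎ Upper q
        decide (a , a∈L , a+2∈U) with p ^ suc n ℚ.<? K ^ a
        ... | yes pⁿ<Kᵃ = inj₁ (inj₂ (a , n , a∈L , pⁿ<Kᵃ))
        ... | no  pⁿ≮Kᵃ = inj₂ (ℚ.<-trans 0<p p<q , 2 ℕ.+ a , n , a+2∈U , (begin-strict
          K ^ (2 ℕ.+ a)             ≡⟨ ^-homo-* K 2 a ⟩
          K ^ 2 ℚ.* K ^ a           <⟨ *-monoʳ-< (^-pos a 0<K) K²<ρⁿ ⟩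
          ρ ^ suc n ℚ.* K ^ a       ≤⟨ *-monoˡ-≤ (^-nonNeg (suc n)
                                         (ℚ.≤-trans (ℚ.<⇒≤ 0<1) (ℚ.<⇒≤ 1<ρ))) (ℚ.≮⇒≥ pⁿ≮Kᵃ) ⟩
          ρ ^ suc n ℚ.* p ^ suc n   ≡⟨ ^-distrib-* ρ p (suc n) ⟨
          (ρ ℚ.* p) ^ suc n         ≡⟨ cong (_^ suc n) ρp≡q ⟩
          q ^ suc n                 ∎))

      locate : ∀ {p q} → p ℚ.< q → Lower p ⊎ Upper q
      locate {p} {q} p<q with ℚ.<-cmp p 0ℚ
      ... | tri< p<0 _ _ = inj₁ (inj₁ p<0)
      ... | tri≈ _ refl _ = inj₁ (inj₂ (0 , 0 , 0∈L , 0<1))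
      ... | tri> _ _ 0<p =
        let ρ , ρp≡q = divide q 0<p
            1<ρ      = *-cancelʳ-< {1ℚ} {ρ} {p} 0<p
                         (subst₂ ℚ._<_ (sym (ℚ.*-identityˡ p)) (sym ρp≡q) p<q)
        in compare 0<p p<q 1<ρ ρp≡q (unbounded (K ^ 2) 1<ρ)

    power : ℝ
    power = record
      { L           = Lower
      ; U           = Upper
      ; L-inhabited = ℚ.- 1ℚ , inj₁ (ℚ.negative⁻¹ (ℚ.- 1ℚ))
      ; U-inhabited = upper-inhabited
      ; L-lower     = lower-lower
      ; U-upper     = upper-upper
      ; L-open      = lower-open
      ; U-open      = upper-open
      ; disjoint    = not-both
      ; located     = locate
      }

  natPower : (k : ℕ) .{{_ : ℕ.NonZero k}} (r : ℝ) → 0ℝ <ℝ r → ℝ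
  natPower k = power (+ k / 1) (1≤k/1 k)

open RealPower public using (natPower)

fieldRawRing : ∀ {c ℓ₁ ℓ₂} → HeytingField c ℓ₁ ℓ₂ → RawRing c ℓ₁
fieldRawRing F = CommutativeRing.rawRing
  (HeytingCommutativeRing.commutativeRing (HeytingField.heytingCommutativeRing F))

-- A polynomial is the list of its coefficients, constant term first, up to
-- trailing zeros.

module Polynomial {c ℓ} (R : RawRing c ℓ) where

  open RawRing R

  Poly : Set c
  Poly = List Carrier

  coeff : Poly → ℕ → Carrier
  coeff []      _       = 0#
  coeff (a ∷ f) zero    = a
  coeff (a ∷ f) (suc i) = coeff f i

  infix  4 _≈ₚ_
  infixl 6 _+ₚ_
  infixl 7 _*ₚ_

  _≈ₚ_ : Poly → Poly → Set ℓ
  f ≈ₚ g = ∀ i → coeff f i ≈ coeff g i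

  _+ₚ_ : Poly → Poly → Poly
  []      +ₚ g       = g
  (a ∷ f) +ₚ []      = a ∷ f
  (a ∷ f) +ₚ (b ∷ g) = a + b ∷ f +ₚ g

  _*ₚ_ : Poly → Poly → Poly
  []      *ₚ g = []
  (a ∷ f) *ₚ g = map (a *_) g +ₚ (0# ∷ f *ₚ g)

  const : Carrier → Poly
  const a = a ∷ []

  polyRawRing : RawRing c ℓ
  polyRawRing = record
    { Carrier = Poly
    ; _≈_     = _≈ₚ_
    ; _+_     = _+ₚ_
    ; _*_     = _*ₚ_
    ; -_      = map (-_)
    ; 0#      = []
    ; 1#      = const 1#
    }

  open RawSemiringDefs (RawRing.rawSemiring polyRawRing) public
    using (_∣_; _^_; Irreducible) renaming (sum to sumₚ)

  infixl 6 _-ₚ_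

  _-ₚ_ : Poly → Poly → Poly
  f -ₚ g = f +ₚ map (-_) g

  HasDegree : Poly → ℕ → Set ℓ
  HasDegree f n = ¬ (coeff f n ≈ 0#) × (∀ i → n ℕ.< i → coeff f i ≈ 0#)

  MonicOfDegree : Poly → ℕ → Set ℓ
  MonicOfDegree f n = coeff f n ≈ 1# × (∀ i → n ℕ.< i → coeff f i ≈ 0#)

  fromℕₚ : ℕ → Poly
  fromℕₚ m = const (RawMonoidDefs._×_ +-rawMonoid m 1#)

  infix 4 _≡_mod_

  _≡_mod_ : Poly → Poly → Poly → Set (c ⊔ ℓ)
  f ≡ g mod p = p ∣ f -ₚ g

  -- f ∈ 𝓡ₙ(g; r₁, …, rₜ), where δ is the degree of g and m i = ⌊ k i ^ r i ⌋.
  record 𝓡 (g : Poly) (δ : ℕ) {t : ℕ} (r : Vector ℝ t) (r>0 : ∀ i → 0ℝ <ℝ r i)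
           (n : ℕ) (f : Poly) : Set (c ⊔ ℓ) where
    field
      f-monic        : MonicOfDegree f n
      h              : Poly
      h-monic        : MonicOfDegree h n
      h-irreducible  : Irreducible h
      k              : Vector ℕ t
      {{k-positive}} : ∀ {i} → ℕ.NonZero (k i)
      m              : Vector ℕ t
      m-floor        : ∀ i → IsFloor (natPower (k i) (r i) (r>0 i)) (m i)
      m-bound        : ∀ i → δ ℕ.* m i ℕ.< n
      representation : f ≈ₚ h +ₚ sumₚ (λ i → g ^ m i)

{-# OPTIONS --safe #-}
-- Let p be a monic irreducible factor of g - 1.  Then g ^ m ≡ 1 (mod p) for every
-- m, so a representation f ≈ h + g ^ m₁ + ⋯ + g ^ mₜ with f ≡ t (mod p) makes p
-- divide h, which is impossible since h is irreducible and deg p < deg h.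
module Submission where

open import Defs
open import Algebra.Apartness.Bundles using (HeytingCommutativeRing; HeytingField)
open import Algebra.Bundles using (AbelianGroup; CommutativeRing; RawRing)
import Algebra.Properties.AbelianGroup as AbelianGroupProperties
import Algebra.Properties.CommutativeSemigroup as CommutativeSemigroupProperties
import Algebra.Properties.Ring as RingProperties
import Algebra.Properties.Semiring.Divisibility as SemiringDivisibility
import Algebra.Properties.CommutativeMagma.Divisibility as CommutativeMagmaDivisibility
import Algebra.Definitions.RawSemiring as RawSemiringDefs
open import Data.Fin.Base as Fin using (Fin)
import Data.Fin.Properties as Fin
open import Data.List.Base using ([]; _∷_; map)
open import Data.Nat.Base as ℕ using (ℕ; zero; suc; _<_; _≤_; z≤n; s≤s)
open import Data.Nat.Induction using (<-rec)
import Data.Nat.Properties as ℕ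
open import Data.Product.Base using (∃; ∃₂; ∃-syntax; _×_; _,_; proj₁)
open import Data.Sum.Base using (_⊎_; inj₁; inj₂; map₁)
open import Data.Vec.Functional using (Vector)
open import Function.Base using (_∘_)
open import Function.Bundles using (Inverse)
open import Relation.Binary.Bundles using (Setoid)
open import Relation.Binary.Definitions using (_Respects_; tri<; tri≈; tri>)
import Relation.Binary.Definitions as B
open import Relation.Binary.PropositionalEquality as ≡ using (_≡_; setoid)
import Relation.Binary.Reasoning.Setoid as SetoidReasoning
open import Relation.Nullary using (Dec; ¬_; yes; no; contradiction)
open import Relation.Nullary.Decidable using (map′; _×-dec_; ¬?; decidable-stable)
open import Relation.Unary using (Pred; Decidable)

-- Equality and exhaustive search on a setoid with `q` classes.

module FiniteSetoid {a ℓ} (S : Setoid a ℓ) {q : ℕ} (S↔Fin : Inverse S (setoid (Fin q))) where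

  open Setoid S
  open Inverse S↔Fin

  infix 4 _≟_

  _≟_ : B.Decidable _≈_
  x ≟ y = map′ injective to-cong (to x Fin.≟ to y)
    where
    injective : to x ≡ to y → x ≈ y
    injective eq = trans (sym (inverseʳ ≡.refl)) (inverseʳ eq)

  -- The search visits only the representatives `from i`, so `P` must respect `_≈_`: a witness `x`
  -- is first moved to the representative of its class.
  any? : ∀ {p} {P : Pred Carrier p} → P Respects _≈_ → Decidable P → Dec (∃ P)
  any? resp P? = map′
    (λ (i , p) → from i , p)
    (λ (x , p) → to x , resp (sym (inverseʳ ≡.refl)) p)
    (Fin.any? (λ i → P? (from i)))

-- Divisibility and congruences in a commutative ring.

module Congruence {c ℓ} (A : CommutativeRing c ℓ) where

  open CommutativeRing A
  open RawSemiringDefs (RawRing.rawSemiring rawRing) using (_∣_; _^_; sum) renaming (_×_ to _×ᴿ_)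
  open CommutativeMagmaDivisibility *-commutativeMagma using (_,_)
  open RingProperties ring using (-‿distribʳ-*; -‿+-comm)
  open CommutativeSemigroupProperties +-commutativeSemigroup using (interchange)
  open SetoidReasoning (CommutativeRing.setoid A)

  ∣x∧∣y⇒∣x+y : ∀ {p x y} → p ∣ x → p ∣ y → p ∣ x + y
  ∣x∧∣y⇒∣x+y {p} (a , ap≈x) (b , bp≈y) =
    a + b , trans (distribʳ p a b) (+-cong ap≈x bp≈y)

  ∣x⇒∣yx : ∀ {p x} y → p ∣ x → p ∣ y * x
  ∣x⇒∣yx {p} y (a , ap≈x) = y * a , trans (*-assoc y a p) (*-congˡ ap≈x)

  ∣-respʳ : ∀ {p x y} → x ≈ y → p ∣ x → p ∣ y
  ∣-respʳ x≈y (a , ap≈x) = a , trans ap≈x x≈y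

  ∣x⇒∣-x : ∀ {p x} → p ∣ x → p ∣ - x
  ∣x⇒∣-x {p} (a , ap≈x) = - a ,
    trans (sym (RingProperties.-‿distribˡ-* ring a p)) (-‿cong ap≈x)

  ∣0 : ∀ p → p ∣ 0#
  ∣0 p = 0# , zeroˡ p

  +-−-interchange : ∀ x y z w → (x - z) + (y - w) ≈ (x + y) - (z + w)
  +-−-interchange x y z w = begin
    (x - z) + (y - w)      ≈⟨ interchange x (- z) y (- w) ⟩
    (x + y) + (- z + - w)  ≈⟨ +-congˡ (-‿+-comm z w) ⟩
    (x + y) - (z + w)      ∎

  -- Induction on `m` through the identity x^(m+1) - 1 = x (x^m - 1) + (x - 1).
  ∣x-1⇒∣xᵐ-1 : ∀ {p x} m → p ∣ x - 1# → p ∣ x ^ m - 1#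
  ∣x-1⇒∣xᵐ-1 {p} zero _ = ∣-respʳ (sym (-‿inverseʳ 1#)) (∣0 p)
  ∣x-1⇒∣xᵐ-1 {p} {x} (suc m) p∣x-1 =
    ∣-respʳ telescope (∣x∧∣y⇒∣x+y (∣x⇒∣yx x (∣x-1⇒∣xᵐ-1 m p∣x-1)) p∣x-1)
    where
    telescope : x * (x ^ m - 1#) + (x - 1#) ≈ x * x ^ m - 1#
    telescope = begin
      x * (x ^ m - 1#) + (x - 1#)         ≈⟨ +-congʳ (distribˡ x (x ^ m) (- 1#)) ⟩
      (x * x ^ m + x * - 1#) + (x - 1#)   ≈⟨ +-congʳ (+-congˡ (-‿distribʳ-* x 1#)) ⟨
      (x * x ^ m - x * 1#) + (x - 1#)     ≈⟨ +-congʳ (+-congˡ (-‿cong (*-identityʳ x))) ⟩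
      (x * x ^ m - x) + (x - 1#)          ≈⟨ +-assoc _ _ _ ⟩
      x * x ^ m + (- x + (x - 1#))        ≈⟨ +-congˡ (+-assoc _ _ _) ⟨
      x * x ^ m + ((- x + x) - 1#)        ≈⟨ +-congˡ (+-congʳ (-‿inverseˡ x)) ⟩
      x * x ^ m + (0# - 1#)               ≈⟨ +-congˡ (+-identityˡ _) ⟩
      x * x ^ m - 1#                      ∎

  -- Each summand is congruent to 1, and the differences `v i - 1#` add up to the difference of the
  -- two sums.
  ∣sum-n : ∀ {p n} (v : Vector Carrier n) → (∀ i → p ∣ v i - 1#) → p ∣ sum v - n ×ᴿ 1#
  ∣sum-n {p} {zero}  v _    = ∣-respʳ (sym (-‿inverseʳ 0#)) (∣0 p)
  ∣sum-n {p} {suc n} v p∣v-1 = ∣-respʳ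
    (+-−-interchange (v Fin.zero) (sum (v ∘ Fin.suc)) 1# (n ×ᴿ 1#))
    (∣x∧∣y⇒∣x+y (p∣v-1 Fin.zero) (∣sum-n (v ∘ Fin.suc) (p∣v-1 ∘ Fin.suc)))

  -- Both `f` and `s` are congruent to `t`, and `h` equals (f - t) - (s - t).
  ∣summand : ∀ {p} f h s t → f ≈ h + s → p ∣ f - t → p ∣ s - t → p ∣ h
  ∣summand f h s t f≈h+s p∣f-t p∣s-t =
    ∣-respʳ cancel (∣x∧∣y⇒∣x+y p∣f-t (∣x⇒∣-x p∣s-t))
    where
    cancel : (f - t) - (s - t) ≈ h
    cancel = begin
      (f - t) - (s - t)        ≈⟨ +-congʳ (+-congʳ f≈h+s) ⟩
      ((h + s) - t) - (s - t)  ≈⟨ +-congʳ (+-assoc h s (- t)) ⟩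
      (h + (s - t)) - (s - t)  ≈⟨ +-assoc h (s - t) (- (s - t)) ⟩
      h + ((s - t) - (s - t))  ≈⟨ +-congˡ (-‿inverseʳ (s - t)) ⟩
      h + 0#                   ≈⟨ +-identityʳ h ⟩
      h                        ∎

-- Coefficient lists form a commutative ring.

module PolynomialRing {c ℓ} (R : CommutativeRing c ℓ) where

  open CommutativeRing R
  open Polynomial rawRing
  open RingProperties ring using (-0#≈0#)

  infixr 8 _·_

  _·_ : Carrier → Poly → Poly
  a · f = map (a *_) f

  -ₚ_ : Poly → Poly
  -ₚ_ = map (-_)

  -- Equality of polynomials is coefficientwise, so this formula, `coeff-·` and `coeff-neg` reduce
  -- the laws of addition and scalar multiplication to those of `R`.
  coeff-+ : ∀ f g i → coeff (f +ₚ g) i ≈ coeff f i + coeff g i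
  coeff-+ []      g       i       = sym (+-identityˡ (coeff g i))
  coeff-+ (a ∷ f) []      i       = sym (+-identityʳ (coeff (a ∷ f) i))
  coeff-+ (a ∷ f) (b ∷ g) zero    = refl
  coeff-+ (a ∷ f) (b ∷ g) (suc i) = coeff-+ f g i

  coeff-· : ∀ a f i → coeff (a · f) i ≈ a * coeff f i
  coeff-· a []      i       = sym (zeroʳ a)
  coeff-· a (b ∷ f) zero    = refl
  coeff-· a (b ∷ f) (suc i) = coeff-· a f i

  coeff-neg : ∀ f i → coeff (-ₚ f) i ≈ - coeff f i
  coeff-neg []      i       = sym -0#≈0#
  coeff-neg (a ∷ f) zero    = refl
  coeff-neg (a ∷ f) (suc i) = coeff-neg f i

  ∷-cong : ∀ {a b} f g → a ≈ b → f ≈ₚ g → a ∷ f ≈ₚ b ∷ g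
  ∷-cong f g a≈b f≈g zero    = a≈b
  ∷-cong f g a≈b f≈g (suc i) = f≈g i

  0∷[]≈[] : 0# ∷ [] ≈ₚ []
  0∷[]≈[] zero    = refl
  0∷[]≈[] (suc i) = refl

  +ₚ-cong : ∀ {f g h k} → f ≈ₚ g → h ≈ₚ k → f +ₚ h ≈ₚ g +ₚ k
  +ₚ-cong {f} {g} {h} {k} f≈g h≈k i =
    trans (coeff-+ f h i) (trans (+-cong (f≈g i) (h≈k i)) (sym (coeff-+ g k i)))

  +ₚ-assoc : ∀ f g h → (f +ₚ g) +ₚ h ≈ₚ f +ₚ (g +ₚ h)
  +ₚ-assoc f g h i = begin
    coeff ((f +ₚ g) +ₚ h) i                ≈⟨ coeff-+ (f +ₚ g) h i ⟩
    coeff (f +ₚ g) i + coeff h i           ≈⟨ +-congʳ (coeff-+ f g i) ⟩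
    (coeff f i + coeff g i) + coeff h i    ≈⟨ +-assoc _ _ _ ⟩
    coeff f i + (coeff g i + coeff h i)    ≈⟨ +-congˡ (coeff-+ g h i) ⟨
    coeff f i + coeff (g +ₚ h) i           ≈⟨ coeff-+ f (g +ₚ h) i ⟨
    coeff (f +ₚ (g +ₚ h)) i                ∎
    where open SetoidReasoning (CommutativeRing.setoid R)

  +ₚ-comm : ∀ f g → f +ₚ g ≈ₚ g +ₚ f
  +ₚ-comm f g i = trans (coeff-+ f g i) (trans (+-comm _ _) (sym (coeff-+ g f i)))

  +ₚ-identityʳ : ∀ f → f +ₚ [] ≈ₚ f
  +ₚ-identityʳ f i = trans (+ₚ-comm f [] i) refl

  +ₚ-inverseʳ : ∀ f → f -ₚ f ≈ₚ []
  +ₚ-inverseʳ f i = trans (coeff-+ f (-ₚ f) i)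
    (trans (+-congˡ (coeff-neg f i)) (-‿inverseʳ (coeff f i)))

  -ₚ-cong : ∀ {f g} → f ≈ₚ g → -ₚ f ≈ₚ -ₚ g
  -ₚ-cong {f} {g} f≈g i =
    trans (coeff-neg f i) (trans (-‿cong (f≈g i)) (sym (coeff-neg g i)))

  +ₚ-abelianGroup : AbelianGroup c ℓ
  +ₚ-abelianGroup = record
    { Carrier = Poly
    ; _≈_     = _≈ₚ_
    ; _∙_     = _+ₚ_
    ; ε       = []
    ; _⁻¹     = -ₚ_
    ; isAbelianGroup = record
      { isGroup = record
        { isMonoid = record
          { isSemigroup = record
            { isMagma = record
              { isEquivalence = record
                { refl  = λ i → refl
                ; sym   = λ f≈g i → sym (f≈g i)
                ; trans = λ f≈g g≈h i → trans (f≈g i) (g≈h i)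
                }
              ; ∙-cong = λ {f} {g} {h} {k} → +ₚ-cong {f} {g} {h} {k}
              }
            ; assoc = +ₚ-assoc
            }
          ; identity = (λ f i → refl) , +ₚ-identityʳ
          }
        ; inverse = (λ f i → trans (+ₚ-comm (-ₚ f) f i) (+ₚ-inverseʳ f i)) , +ₚ-inverseʳ
        ; ⁻¹-cong = λ {f} {g} → -ₚ-cong {f} {g}
        }
      ; comm = +ₚ-comm
      }
    }

  private
    module +ₚ = AbelianGroup +ₚ-abelianGroup
    open CommutativeSemigroupProperties +ₚ.commutativeSemigroup
      using (x∙yz≈y∙xz) renaming (interchange to +ₚ-interchange)

    +ₚ-congˡ : ∀ f g h → g ≈ₚ h → f +ₚ g ≈ₚ f +ₚ h
    +ₚ-congˡ f g h g≈h = +ₚ-cong {f} {f} {g} {h} (λ i → refl) g≈h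

    +ₚ-congʳ : ∀ f g h → g ≈ₚ h → g +ₚ f ≈ₚ h +ₚ f
    +ₚ-congʳ f g h g≈h = +ₚ-cong {g} {h} {f} {f} g≈h (λ i → refl)

  ·-cong : ∀ {a b} f g → a ≈ b → f ≈ₚ g → a · f ≈ₚ b · g
  ·-cong {a} {b} f g a≈b f≈g i =
    trans (coeff-· a f i) (trans (*-cong a≈b (f≈g i)) (sym (coeff-· b g i)))

  ·-distribˡ : ∀ a f g → a · (f +ₚ g) ≈ₚ a · f +ₚ a · g
  ·-distribˡ a f g i = begin
    coeff (a · (f +ₚ g)) i             ≈⟨ coeff-· a (f +ₚ g) i ⟩
    a * coeff (f +ₚ g) i               ≈⟨ *-congˡ (coeff-+ f g i) ⟩
    a * (coeff f i + coeff g i)        ≈⟨ distribˡ a _ _ ⟩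
    a * coeff f i + a * coeff g i      ≈⟨ +-cong (coeff-· a f i) (coeff-· a g i) ⟨
    coeff (a · f) i + coeff (a · g) i  ≈⟨ coeff-+ (a · f) (a · g) i ⟨
    coeff (a · f +ₚ a · g) i           ∎
    where open SetoidReasoning (CommutativeRing.setoid R)

  ·-distribʳ : ∀ a b f → (a + b) · f ≈ₚ a · f +ₚ b · f
  ·-distribʳ a b f i = begin
    coeff ((a + b) · f) i              ≈⟨ coeff-· (a + b) f i ⟩
    (a + b) * coeff f i                ≈⟨ distribʳ _ a b ⟩
    a * coeff f i + b * coeff f i      ≈⟨ +-cong (coeff-· a f i) (coeff-· b f i) ⟨
    coeff (a · f) i + coeff (b · f) i  ≈⟨ coeff-+ (a · f) (b · f) i ⟨
    coeff (a · f +ₚ b · f) i           ∎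
    where open SetoidReasoning (CommutativeRing.setoid R)

  ·-assoc : ∀ a b f → (a * b) · f ≈ₚ a · b · f
  ·-assoc a b f i = begin
    coeff ((a * b) · f) i  ≈⟨ coeff-· (a * b) f i ⟩
    (a * b) * coeff f i    ≈⟨ *-assoc a b _ ⟩
    a * (b * coeff f i)    ≈⟨ *-congˡ (coeff-· b f i) ⟨
    a * coeff (b · f) i    ≈⟨ coeff-· a (b · f) i ⟨
    coeff (a · b · f) i    ∎
    where open SetoidReasoning (CommutativeRing.setoid R)

  ·-zeroˡ : ∀ f → 0# · f ≈ₚ []
  ·-zeroˡ f i = trans (coeff-· 0# f i) (zeroˡ _)

  ·-identityˡ : ∀ f → 1# · f ≈ₚ f
  ·-identityˡ f i = trans (coeff-· 1# f i) (*-identityˡ _)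

  open SetoidReasoning +ₚ.setoid

  -- Prefixing `0#` is multiplication by the indeterminate. This lemma and the next two make it
  -- compatible with sums, products and scalars.
  0∷-+ : ∀ f g → 0# ∷ (f +ₚ g) ≈ₚ (0# ∷ f) +ₚ (0# ∷ g)
  0∷-+ f g = ∷-cong (f +ₚ g) (f +ₚ g) (sym (+-identityˡ 0#)) (λ i → refl)

  0∷-* : ∀ f g → (0# ∷ f) *ₚ g ≈ₚ 0# ∷ f *ₚ g
  0∷-* f g = +ₚ-congʳ (0# ∷ f *ₚ g) (0# · g) [] (·-zeroˡ g)

  ·-0∷ : ∀ a f → a · (0# ∷ f) ≈ₚ 0# ∷ a · f
  ·-0∷ a f = ∷-cong (a · f) (a · f) (zeroʳ a) (λ i → refl)

  ·-*-assoc : ∀ a f g → (a · f) *ₚ g ≈ₚ a · (f *ₚ g)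
  ·-*-assoc a []      g i = refl
  ·-*-assoc a (b ∷ f) g = begin
    (a * b) · g +ₚ (0# ∷ (a · f) *ₚ g)
      ≈⟨ +ₚ-cong {(a * b) · g} {a · b · g} {0# ∷ (a · f) *ₚ g} {0# ∷ a · (f *ₚ g)}
           (·-assoc a b g) (∷-cong ((a · f) *ₚ g) (a · (f *ₚ g)) refl (·-*-assoc a f g)) ⟩
    a · b · g +ₚ (0# ∷ a · (f *ₚ g))
      ≈⟨ +ₚ-congˡ (a · b · g) (a · (0# ∷ f *ₚ g)) (0# ∷ a · (f *ₚ g)) (·-0∷ a (f *ₚ g)) ⟨
    a · b · g +ₚ a · (0# ∷ f *ₚ g)
      ≈⟨ ·-distribˡ a (b · g) (0# ∷ f *ₚ g) ⟨
    a · (b · g +ₚ (0# ∷ f *ₚ g)) ∎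

  *ₚ-distribʳ : ∀ h f g → (f +ₚ g) *ₚ h ≈ₚ f *ₚ h +ₚ g *ₚ h
  *ₚ-distribʳ h []      g i = refl
  *ₚ-distribʳ h (a ∷ f) [] i = sym (+ₚ-identityʳ ((a ∷ f) *ₚ h) i)
  *ₚ-distribʳ h (a ∷ f) (b ∷ g) = begin
    (a + b) · h +ₚ (0# ∷ (f +ₚ g) *ₚ h)
      ≈⟨ +ₚ-cong {(a + b) · h} {a · h +ₚ b · h}
           {0# ∷ (f +ₚ g) *ₚ h} {0# ∷ (f *ₚ h +ₚ g *ₚ h)} (·-distribʳ a b h)
           (∷-cong ((f +ₚ g) *ₚ h) (f *ₚ h +ₚ g *ₚ h) refl (*ₚ-distribʳ h f g)) ⟩
    (a · h +ₚ b · h) +ₚ (0# ∷ (f *ₚ h +ₚ g *ₚ h))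
      ≈⟨ +ₚ-congˡ (a · h +ₚ b · h) (0# ∷ (f *ₚ h +ₚ g *ₚ h))
           ((0# ∷ f *ₚ h) +ₚ (0# ∷ g *ₚ h)) (0∷-+ (f *ₚ h) (g *ₚ h)) ⟩
    (a · h +ₚ b · h) +ₚ ((0# ∷ f *ₚ h) +ₚ (0# ∷ g *ₚ h))
      ≈⟨ +ₚ-interchange (a · h) (b · h) (0# ∷ f *ₚ h) (0# ∷ g *ₚ h) ⟩
    (a ∷ f) *ₚ h +ₚ (b ∷ g) *ₚ h ∎

  *ₚ-assoc : ∀ f g h → (f *ₚ g) *ₚ h ≈ₚ f *ₚ (g *ₚ h)
  *ₚ-assoc []      g h i = refl
  *ₚ-assoc (a ∷ f) g h = begin
    (a · g +ₚ (0# ∷ f *ₚ g)) *ₚ h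
      ≈⟨ *ₚ-distribʳ h (a · g) (0# ∷ f *ₚ g) ⟩
    (a · g) *ₚ h +ₚ (0# ∷ f *ₚ g) *ₚ h
      ≈⟨ +ₚ-cong {(a · g) *ₚ h} {a · (g *ₚ h)} {(0# ∷ f *ₚ g) *ₚ h} {0# ∷ (f *ₚ g) *ₚ h}
           (·-*-assoc a g h) (0∷-* (f *ₚ g) h) ⟩
    a · (g *ₚ h) +ₚ (0# ∷ (f *ₚ g) *ₚ h)
      ≈⟨ +ₚ-congˡ (a · (g *ₚ h)) (0# ∷ (f *ₚ g) *ₚ h) (0# ∷ f *ₚ (g *ₚ h))
           (∷-cong ((f *ₚ g) *ₚ h) (f *ₚ (g *ₚ h)) refl (*ₚ-assoc f g h)) ⟩
    (a ∷ f) *ₚ (g *ₚ h) ∎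

  *ₚ-zeroʳ : ∀ f → f *ₚ [] ≈ₚ []
  *ₚ-zeroʳ []      i       = refl
  *ₚ-zeroʳ (a ∷ f) zero    = refl
  *ₚ-zeroʳ (a ∷ f) (suc i) = *ₚ-zeroʳ f i

  -- The mirror image of the defining recursion of `_*ₚ_`, now along the right factor. Commutativity
  -- follows from it by induction on that factor.
  *ₚ-∷ʳ : ∀ f b g → f *ₚ (b ∷ g) ≈ₚ b · f +ₚ (0# ∷ f *ₚ g)
  *ₚ-∷ʳ []      b g i = sym (0∷[]≈[] i)
  *ₚ-∷ʳ (a ∷ f) b g =
    ∷-cong (a · g +ₚ f *ₚ (b ∷ g)) (b · f +ₚ (a ∷ f) *ₚ g) (+-congʳ (*-comm a b)) (begin
      a · g +ₚ f *ₚ (b ∷ g)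
        ≈⟨ +ₚ-congˡ (a · g) (f *ₚ (b ∷ g)) (b · f +ₚ (0# ∷ f *ₚ g)) (*ₚ-∷ʳ f b g) ⟩
      a · g +ₚ (b · f +ₚ (0# ∷ f *ₚ g))
        ≈⟨ x∙yz≈y∙xz (a · g) (b · f) (0# ∷ f *ₚ g) ⟩
      b · f +ₚ (a ∷ f) *ₚ g ∎)

  *ₚ-comm : ∀ f g → f *ₚ g ≈ₚ g *ₚ f
  *ₚ-comm f []      = *ₚ-zeroʳ f
  *ₚ-comm f (b ∷ g) = begin
    f *ₚ (b ∷ g)               ≈⟨ *ₚ-∷ʳ f b g ⟩
    b · f +ₚ (0# ∷ f *ₚ g)     ≈⟨ +ₚ-congˡ (b · f) (0# ∷ f *ₚ g) (0# ∷ g *ₚ f)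
                                    (∷-cong (f *ₚ g) (g *ₚ f) refl (*ₚ-comm f g)) ⟩
    (b ∷ g) *ₚ f               ∎

  *ₚ-congˡ : ∀ f g h → g ≈ₚ h → f *ₚ g ≈ₚ f *ₚ h
  *ₚ-congˡ []      g h g≈h i = refl
  *ₚ-congˡ (a ∷ f) g h g≈h = +ₚ-cong {a · g} {a · h} {0# ∷ f *ₚ g} {0# ∷ f *ₚ h}
    (·-cong g h refl g≈h) (∷-cong (f *ₚ g) (f *ₚ h) refl (*ₚ-congˡ f g h g≈h))

  -- Equal polynomials may be lists of different lengths, which blocks a direct recursion on the
  -- left factors. Commutativity moves them to the right, where `*ₚ-congˡ` recurses on the common
  -- factor instead.
  *ₚ-congʳ : ∀ f g h → g ≈ₚ h → g *ₚ f ≈ₚ h *ₚ f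
  *ₚ-congʳ f g h g≈h = begin
    g *ₚ f  ≈⟨ *ₚ-comm g f ⟩
    f *ₚ g  ≈⟨ *ₚ-congˡ f g h g≈h ⟩
    f *ₚ h  ≈⟨ *ₚ-comm f h ⟩
    h *ₚ f  ∎

  const-* : ∀ a f → const a *ₚ f ≈ₚ a · f
  const-* a f = begin
    a · f +ₚ (0# ∷ [])  ≈⟨ +ₚ-congˡ (a · f) (0# ∷ []) [] 0∷[]≈[] ⟩
    a · f +ₚ []         ≈⟨ +ₚ-identityʳ (a · f) ⟩
    a · f               ∎

  *ₚ-identityˡ : ∀ f → const 1# *ₚ f ≈ₚ f
  *ₚ-identityˡ f = begin
    const 1# *ₚ f  ≈⟨ const-* 1# f ⟩
    1# · f         ≈⟨ ·-identityˡ f ⟩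
    f              ∎

  polyRing : CommutativeRing c ℓ
  polyRing = record
    { Carrier = Poly
    ; _≈_     = _≈ₚ_
    ; _+_     = _+ₚ_
    ; _*_     = _*ₚ_
    ; -_      = -ₚ_
    ; 0#      = []
    ; 1#      = const 1#
    ; isCommutativeRing = record
      { isRing = record
        { +-isAbelianGroup = +ₚ.isAbelianGroup
        ; *-cong     = λ {f} {g} {h} {k} f≈g h≈k i →
            trans (*ₚ-congʳ h f g f≈g i) (*ₚ-congˡ g h k h≈k i)
        ; *-assoc    = *ₚ-assoc
        ; *-identity = *ₚ-identityˡ
                     , λ f i → trans (*ₚ-comm f (const 1#) i) (*ₚ-identityˡ f i)
        ; distrib    = (λ f g h → begin
            f *ₚ (g +ₚ h)       ≈⟨ *ₚ-comm f (g +ₚ h) ⟩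
            (g +ₚ h) *ₚ f       ≈⟨ *ₚ-distribʳ f g h ⟩
            g *ₚ f +ₚ h *ₚ f    ≈⟨ +ₚ-cong {g *ₚ f} {f *ₚ g} {h *ₚ f} {f *ₚ h}
                                     (*ₚ-comm g f) (*ₚ-comm h f) ⟩
            f *ₚ g +ₚ f *ₚ h    ∎) , *ₚ-distribʳ
        }
      ; *-comm = *ₚ-comm
      }
    }

  -- Degree bounds and leading coefficients of products.

  -- The strict bound gives the zero polynomial a place below `0`. Degree at most `n` is
  -- `DegreeBelow f (suc n)`, which unfolds to the second component of `HasDegree f n`.
  DegreeBelow : Poly → ℕ → Set ℓ
  DegreeBelow f n = ∀ i → n ≤ i → coeff f i ≈ 0#

  tail-degreeBelow : ∀ a f {n} → DegreeBelow (a ∷ f) (suc n) → DegreeBelow f n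
  tail-degreeBelow a f f<1+n i n≤i = f<1+n (suc i) (s≤s n≤i)

  degreeBelow0⇒*≈[] : ∀ f g → DegreeBelow f 0 → f *ₚ g ≈ₚ []
  degreeBelow0⇒*≈[] f g f<0 = *ₚ-congʳ g f [] (λ i → f<0 i z≤n)

  coeff-∷-* : ∀ x f g i → coeff ((x ∷ f) *ₚ g) i ≈ x * coeff g i + coeff (0# ∷ f *ₚ g) i
  coeff-∷-* x f g i = trans (coeff-+ (x · g) (0# ∷ f *ₚ g) i) (+-congʳ (coeff-· x g i))

  *-degreeBelow : ∀ f g a b → DegreeBelow f (suc a) → DegreeBelow g (suc b) →
                  DegreeBelow (f *ₚ g) (suc (a ℕ.+ b))
  *-degreeBelow []      g a b f≤a g≤b i _ = refl
  *-degreeBelow (x ∷ f) g a b f≤a g≤b (suc i) (s≤s a+b≤i) =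
    trans (coeff-∷-* x f g (suc i)) (trans (+-cong x*gᵢ≈0 (fg≈0 a f≤a a+b≤i)) (+-identityʳ 0#))
    where
    x*gᵢ≈0 : x * coeff g (suc i) ≈ 0#
    x*gᵢ≈0 = trans (*-congˡ (g≤b (suc i) (s≤s (ℕ.≤-trans (ℕ.m≤n+m b a) a+b≤i)))) (zeroʳ x)
    fg≈0 : ∀ a → DegreeBelow (x ∷ f) (suc a) → a ℕ.+ b ≤ i → coeff (f *ₚ g) i ≈ 0#
    -- With `a` equal to 0 the tail `f` is the zero polynomial, though possibly a nonempty list of
    -- zeros.
    fg≈0 zero    f≤a _     = degreeBelow0⇒*≈[] f g (tail-degreeBelow x f f≤a) i
    fg≈0 (suc a) f≤a a+b≤i =
      *-degreeBelow f g a b (tail-degreeBelow x f f≤a) g≤b i a+b≤i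

  -- Among the products of coefficients whose indices sum to `a + b`, all but one have an index
  -- above its bound and vanish.
  *-topCoeff : ∀ f g a b → DegreeBelow f (suc a) → DegreeBelow g (suc b) →
               coeff (f *ₚ g) (a ℕ.+ b) ≈ coeff f a * coeff g b
  *-topCoeff []      g a       b f≤a g≤b = sym (zeroˡ (coeff g b))
  *-topCoeff (x ∷ f) g zero    b f≤0 g≤b =
    trans (coeff-∷-* x f g b) (trans (+-congˡ (0∷fg≈0 b)) (+-identityʳ _))
    where
    0∷fg≈0 : ∀ i → coeff (0# ∷ f *ₚ g) i ≈ 0#
    0∷fg≈0 zero    = refl
    0∷fg≈0 (suc i) = degreeBelow0⇒*≈[] f g (tail-degreeBelow x f f≤0) i
  *-topCoeff (x ∷ f) g (suc a) b f≤a g≤b =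
    trans (coeff-∷-* x f g (suc (a ℕ.+ b)))
      (trans (+-cong x*g≈0 (*-topCoeff f g a b (tail-degreeBelow x f f≤a) g≤b)) (+-identityˡ _))
    where
    x*g≈0 : x * coeff g (suc (a ℕ.+ b)) ≈ 0#
    x*g≈0 = trans (*-congˡ (g≤b (suc (a ℕ.+ b)) (s≤s (ℕ.m≤n+m b a)))) (zeroʳ x)

  hasDegree-unique : ∀ f g {m n} → f ≈ₚ g → HasDegree f m → HasDegree g n → m ≡ n
  hasDegree-unique f g {m} {n} f≈g (fₘ≉0 , f≤m) (gₙ≉0 , g≤n) with ℕ.<-cmp m n
  ... | tri< m<n _ _ = contradiction (trans (sym (f≈g n)) (f≤m n m<n)) gₙ≉0
  ... | tri≈ _ m≡n _ = m≡n
  ... | tri> _ _ n<m = contradiction (trans (f≈g m) (g≤n m n<m)) fₘ≉0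

  hasDegree⇒≉[] : ∀ f {n} → HasDegree f n → ¬ f ≈ₚ []
  hasDegree⇒≉[] f {n} (fₙ≉0 , _) f≈0 = fₙ≉0 (f≈0 n)

-- Degrees, units and decidable equality over a finite field.

module FiniteField {c ℓ} (R : CommutativeRing c ℓ) {q : ℕ}
  (R↔Fin : Inverse (CommutativeRing.setoid R) (setoid (Fin q)))
  (inverse : ∀ x → ¬ CommutativeRing._≈_ R x (CommutativeRing.0# R) →
             ∃[ y ] CommutativeRing._≈_ R (CommutativeRing._*_ R y x) (CommutativeRing.1# R))
  where

  open CommutativeRing R
  open Polynomial rawRing
  open PolynomialRing R
  open FiniteSetoid (CommutativeRing.setoid R) R↔Fin
  open RawSemiringDefs using (mkIrred)
  open CommutativeMagmaDivisibility (CommutativeRing.*-commutativeMagma polyRing)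
    using (_,_; xy≈z⇒x∣z)
  open SemiringDivisibility (CommutativeRing.semiring polyRing) using (∣ʳ-trans; ∣ʳ-refl)
  open Irreducible

  -- Nontriviality of the ring is read off from any nonzero element, later always a leading
  -- coefficient.
  x≉0⇒1≉0 : ∀ {x} → ¬ x ≈ 0# → ¬ 1# ≈ 0#
  x≉0⇒1≉0 {x} x≉0 1≈0 = x≉0 (trans (sym (*-identityˡ x)) (trans (*-congʳ 1≈0) (zeroˡ x)))

  *-nonzero : ∀ {x y} → ¬ x ≈ 0# → ¬ y ≈ 0# → ¬ x * y ≈ 0#
  *-nonzero {x} {y} x≉0 y≉0 xy≈0 = let x⁻¹ , x⁻¹x≈1 = inverse x x≉0 in y≉0 (begin
    y              ≈⟨ *-identityˡ y ⟨
    1# * y         ≈⟨ *-congʳ x⁻¹x≈1 ⟨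
    (x⁻¹ * x) * y  ≈⟨ *-assoc x⁻¹ x y ⟩
    x⁻¹ * (x * y)  ≈⟨ *-congˡ xy≈0 ⟩
    x⁻¹ * 0#       ≈⟨ zeroʳ x⁻¹ ⟩
    0#             ∎)
    where open SetoidReasoning (CommutativeRing.setoid R)

  hasDegree-* : ∀ f g {a b} → HasDegree f a → HasDegree g b → HasDegree (f *ₚ g) (a ℕ.+ b)
  hasDegree-* f g {a} {b} (fₐ≉0 , f≤a) (g_b≉0 , g≤b) =
    (λ fg≈0 → *-nonzero fₐ≉0 g_b≉0 (trans (sym (*-topCoeff f g a b f≤a g≤b)) fg≈0)) ,
    *-degreeBelow f g a b f≤a g≤b

  -- A list may end in zeros, so its length does not give the degree. The tail is examined first,
  -- and the head matters only when the tail vanishes.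
  degree : ∀ f → f ≈ₚ [] ⊎ ∃ (HasDegree f)
  degree []      = inj₁ (λ i → refl)
  degree (a ∷ f) with degree f | a ≟ 0#
  ... | inj₂ (n , fₙ≉0 , f≤n) | _ = inj₂ (suc n , fₙ≉0 , λ { (suc i) (s≤s n<i) → f≤n i n<i })
  ... | inj₁ f≈0 | no  a≉0 = inj₂ (0 , a≉0 , λ { (suc i) _ → f≈0 i })
  ... | inj₁ f≈0 | yes a≈0 = inj₁ (λ { zero → a≈0 ; (suc i) → f≈0 i })

  ≈[]? : ∀ f → Dec (f ≈ₚ [])
  ≈[]? f with degree f
  ... | inj₁ f≈0      = yes f≈0
  ... | inj₂ (n , fₙ) = no (hasDegree⇒≉[] f fₙ)

  infix 4 _≟ₚ_

  _≟ₚ_ : ∀ f g → Dec (f ≈ₚ g)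
  f ≟ₚ g = map′ (x∙y⁻¹≈ε⇒x≈y f g) (x≈y⇒x∙y⁻¹≈ε {f} {g}) (≈[]? (f -ₚ g))
    where open AbelianGroupProperties +ₚ-abelianGroup using (x∙y⁻¹≈ε⇒x≈y; x≈y⇒x∙y⁻¹≈ε)

  -- A zero factor would make the nonzero product `h` vanish, so both factors have degrees. Over a
  -- field these add, and the degree of `h` is unique.
  hasDegree-factors : ∀ f g h {n} → f *ₚ g ≈ₚ h → HasDegree h n →
                      ∃₂ λ a b → HasDegree f a × HasDegree g b × a ℕ.+ b ≡ n
  hasDegree-factors f g h fg≈h hₙ with degree f | degree g
  ... | inj₁ f≈0 | _ = contradiction
    (λ i → trans (sym (fg≈h i)) (*ₚ-congʳ g f [] f≈0 i)) (hasDegree⇒≉[] h hₙ)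
  ... | inj₂ _ | inj₁ g≈0 = contradiction
    (λ i → trans (sym (fg≈h i)) (trans (*ₚ-congˡ f g [] g≈0 i) (*ₚ-zeroʳ f i)))
    (hasDegree⇒≉[] h hₙ)
  ... | inj₂ (a , fₐ) | inj₂ (b , g_b) =
    a , b , fₐ , g_b , hasDegree-unique (f *ₚ g) h fg≈h (hasDegree-* f g fₐ g_b) hₙ

  hasDegree-1 : ¬ 1# ≈ 0# → HasDegree (const 1#) 0
  hasDegree-1 1≉0 = 1≉0 , λ { (suc i) _ → refl }

  ∣1⇒degree≡0 : ∀ f {n} → HasDegree f n → f ∣ const 1# → n ≡ 0
  ∣1⇒degree≡0 f fₙ@(fₙ≉0 , _) (g , gf≈1) =
    let a , b , _ , f_b , a+b≡0 =
          hasDegree-factors g f (const 1#) gf≈1 (hasDegree-1 (x≉0⇒1≉0 fₙ≉0))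
    in ≡.trans (hasDegree-unique f f (λ i → refl) fₙ f_b) (ℕ.m+n≡0⇒n≡0 a a+b≡0)

  -- Zero is included. Among nonzero polynomials the constants are exactly the units, and unlike the
  -- existence of an inverse, constancy is tested by one comparison.
  Constant : Poly → Set ℓ
  Constant f = f ≈ₚ const (coeff f 0)

  constant-resp : Constant Respects _≈ₚ_
  constant-resp {f} {g} f≈g f-const i = trans (sym (f≈g i)) (trans (f-const i)
    (∷-cong {coeff f 0} {coeff g 0} [] [] (f≈g 0) (λ _ → refl) i))

  degree0⇒constant : ∀ f → HasDegree f 0 → Constant f
  degree0⇒constant f (_ , f≤0) zero    = refl
  degree0⇒constant f (_ , f≤0) (suc i) = f≤0 (suc i) (s≤s z≤n)

  ¬constant⇒degree>0 : ∀ f {n} → HasDegree f n → ¬ Constant f → 0 < n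
  ¬constant⇒degree>0 f {zero}  f₀ ¬const = contradiction (degree0⇒constant f f₀) ¬const
  ¬constant⇒degree>0 f {suc n} _  _      = s≤s z≤n

  const∣1 : ∀ {a} → ¬ a ≈ 0# → const a ∣ const 1#
  const∣1 {a} a≉0 = let b , ba≈1 = inverse a a≉0 in const b ,
    λ i → trans (const-* b (const a) i) (∷-cong [] [] ba≈1 (λ _ → refl) i)

  ∣1-resp : ∀ f g → f ≈ₚ g → f ∣ const 1# → g ∣ const 1#
  ∣1-resp f g f≈g (h , hf≈1) = h , λ i → trans (*ₚ-congˡ h g f (λ i → sym (f≈g i)) i) (hf≈1 i)

  constant⇒∣1 : ∀ f → ¬ f ≈ₚ [] → Constant f → f ∣ const 1#
  constant⇒∣1 f f≉0 f-const = ∣1-resp (const (coeff f 0)) f (λ i → sym (f-const i))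
    (const∣1 (λ f₀≈0 → f≉0 (λ i → trans (f-const i)
      (trans (∷-cong [] [] f₀≈0 (λ _ → refl) i) (0∷[]≈[] i)))))

  -- Exhaustive search among polynomials of bounded degree.

  -- Up to equality only q^n polynomials have degree below `n`. The recursion searches for a tail of
  -- degree below `n - 1` that some head, found by `any?`, completes to a witness.
  anyDegreeBelow? : ∀ {p} n {P : Pred Poly p} → P Respects _≈ₚ_ → Decidable P →
                    Dec (∃[ f ] DegreeBelow f n × P f)
  anyDegreeBelow? zero resp P? = map′
    (λ p → [] , (λ _ _ → refl) , p)
    (λ (f , f<0 , p) → resp {f} {[]} (λ i → f<0 i z≤n) p)
    (P? [])
  anyDegreeBelow? (suc n) {P} resp P? = map′
    (λ (f , f<n , a , p) → a ∷ f , (λ { (suc i) (s≤s n≤i) → f<n i n≤i }) , p)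
    split
    (anyDegreeBelow? n {λ f → ∃[ a ] P (a ∷ f)}
      (λ {f} {g} f≈g (a , p) → a , resp {a ∷ f} {a ∷ g} (∷-cong f g refl f≈g) p)
      (λ f → any? (λ {a} {b} a≈b → resp {a ∷ f} {b ∷ f} (∷-cong f f a≈b (λ _ → refl)))
                  (λ a → P? (a ∷ f))))
    where
    split : ∃[ f ] DegreeBelow f (suc n) × P f → ∃[ f ] DegreeBelow f n × ∃[ a ] P (a ∷ f)
    -- The empty list has no head to split off, so zero is rewritten as `0# ∷ []`.
    split ([] , _ , p) =
      [] , (λ _ _ → refl) , 0# , resp {[]} {0# ∷ []} (λ i → sym (0∷[]≈[] i)) p
    split (a ∷ f , f<1+n , p) = f , tail-degreeBelow a f f<1+n , a , p

  -- Irreducible factors of polynomials.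

  Factorisation : Poly → Poly → Poly → Set ℓ
  Factorisation f x y = ¬ Constant x × ¬ Constant y × x *ₚ y ≈ₚ f

  constant? : Decidable Constant
  constant? f = f ≟ₚ const (coeff f 0)

  factorisation? : ∀ n f →
    Dec (∃[ x ] DegreeBelow x n × ∃[ y ] DegreeBelow y n × Factorisation f x y)
  factorisation? n f = anyDegreeBelow? n {λ x → ∃[ y ] DegreeBelow y n × Factorisation f x y}
    (λ {x} {x′} x≈x′ (y , y<n , ¬x , ¬y , xy≈f) → y , y<n ,
      (λ x′-const → ¬x (constant-resp {x′} {x} (λ i → sym (x≈x′ i)) x′-const)) , ¬y ,
      (λ i → trans (*ₚ-congʳ y x′ x (λ i → sym (x≈x′ i)) i) (xy≈f i)))
    (λ x → anyDegreeBelow? n {Factorisation f x}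
      (λ {y} {y′} y≈y′ (¬x , ¬y , xy≈f) → ¬x ,
        (λ y′-const → ¬y (constant-resp {y′} {y} (λ i → sym (y≈y′ i)) y′-const)) ,
        (λ i → trans (*ₚ-congˡ x y′ y (λ i → sym (y≈y′ i)) i) (xy≈f i)))
      (λ y → ¬? (constant? x) ×-dec ¬? (constant? y) ×-dec (x *ₚ y ≟ₚ f)))

  -- In any product equal to `f` both factors are nonzero of degree at most `n`, hence within the
  -- range searched. One of them is therefore constant, and a nonzero constant is a unit.
  unfactorable⇒irreducible : ∀ f {n} → HasDegree f n → 0 < n →
    ¬ (∃[ x ] DegreeBelow x (suc n) × ∃[ y ] DegreeBelow y (suc n) × Factorisation f x y) →
    Irreducible f
  unfactorable⇒irreducible f {n} fₙ 0<n unfactorable = mkIrred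
    (λ f∣1 → ℕ.<-irrefl (≡.sym (∣1⇒degree≡0 f fₙ f∣1)) 0<n)
    (λ {x} {y} f≈xy → split x y f≈xy)
    where
    split : ∀ x y → f ≈ₚ x *ₚ y → x ∣ const 1# ⊎ y ∣ const 1#
    split x y f≈xy
      with hasDegree-factors x y f (λ i → sym (f≈xy i)) fₙ | constant? x | constant? y
    ... | a , b , xₐ , y_b , _ | yes x-const | _ =
      inj₁ (constant⇒∣1 x (hasDegree⇒≉[] x xₐ) x-const)
    ... | a , b , xₐ , y_b , _ | no _ | yes y-const =
      inj₂ (constant⇒∣1 y (hasDegree⇒≉[] y y_b) y-const)
    ... | a , b , (_ , x≤a) , (_ , y≤b) , a+b≡n | no ¬x | no ¬y = contradiction
      ( x , (λ i n<i → x≤a i (ℕ.≤-<-trans (ℕ.m+n≤o⇒m≤o a (ℕ.≤-reflexive a+b≡n)) n<i))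
      , y , (λ i n<i → y≤b i (ℕ.≤-<-trans (ℕ.m+n≤o⇒n≤o a (ℕ.≤-reflexive a+b≡n)) n<i))
      , ¬x , ¬y , (λ i → sym (f≈xy i)))
      unfactorable

  -- Strong induction on the degree. If the search finds no factorisation, `f` itself is
  -- irreducible; otherwise the cofactor `y` has positive degree, so `x` has smaller degree than `f`
  -- and the induction applies to it.
  irreducibleFactor : ∀ n f → HasDegree f n → 0 < n →
                      ∃₂ λ p d → HasDegree p d × Irreducible p × p ∣ f
  -- The bound is `suc n` because `DegreeBelow` is strict and the factors are only known to have
  -- degree at most `n`.
  irreducibleFactor = <-rec _ λ n rec f fₙ 0<n → step n rec f fₙ 0<n (factorisation? (suc n) f)
    where
    step : ∀ n →
      (∀ {m} → m < n → ∀ f → HasDegree f m → 0 < m →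
        ∃₂ λ p d → HasDegree p d × Irreducible p × p ∣ f) →
      ∀ f → HasDegree f n → 0 < n →
      Dec (∃[ x ] DegreeBelow x (suc n) × ∃[ y ] DegreeBelow y (suc n) × Factorisation f x y) →
      ∃₂ λ p d → HasDegree p d × Irreducible p × p ∣ f
    step n rec f fₙ 0<n (no unfactorable) =
      f , n , fₙ , unfactorable⇒irreducible f fₙ 0<n unfactorable , ∣ʳ-refl
    step n rec f fₙ 0<n (yes (x , _ , y , _ , ¬x , ¬y , xy≈f)) =
      let a , b , xₐ , y_b , a+b≡n = hasDegree-factors x y f xy≈f fₙ
          0<b = ¬constant⇒degree>0 y y_b ¬y
          a<n = ≡.subst (a <_) a+b≡n (ℕ.m<m+n a 0<b)
          p , d , p_d , p-irreducible , p∣x = rec a<n x xₐ (¬constant⇒degree>0 x xₐ ¬x)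
      in p , d , p_d , p-irreducible , ∣ʳ-trans p∣x (xy≈z⇒x∣z x y xy≈f)

  -- Dividing by the leading coefficient multiplies by a unit, so `p` and `f` divide each other and
  -- irreducibility carries over.
  normalise : ∀ f {n} → HasDegree f n → Irreducible f →
              ∃[ p ] MonicOfDegree p n × Irreducible p × p ∣ f
  normalise f {n} (fₙ≉0 , f≤n) f-irreducible =
    let a , afₙ≈1 = inverse (coeff f n) fₙ≉0
        p         = a · f
        b         = coeff f n
        bp≈f : b · p ≈ₚ f
        bp≈f i = let open SetoidReasoning (CommutativeRing.setoid R) in begin
          coeff (b · p) i      ≈⟨ coeff-· b p i ⟩
          b * coeff p i        ≈⟨ *-congˡ (coeff-· a f i) ⟩
          b * (a * coeff f i)  ≈⟨ *-assoc b a (coeff f i) ⟨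
          (b * a) * coeff f i  ≈⟨ *-congʳ (trans (*-comm b a) afₙ≈1) ⟩
          1# * coeff f i       ≈⟨ *-identityˡ (coeff f i) ⟩
          coeff f i            ∎
        p∣f : p ∣ f
        p∣f = const b , λ i → trans (const-* b p i) (bp≈f i)
        f∣p : f ∣ p
        f∣p = const a , const-* a f
    in p
     , ( trans (coeff-· a f n) afₙ≈1
       , λ i n<i → trans (coeff-· a f i) (trans (*-congˡ (f≤n i n<i)) (zeroʳ a)))
     , mkIrred
         (λ p∣1 → p∤1 f-irreducible (∣ʳ-trans f∣p p∣1))
         -- A product p = x y gives f = (b x) y. If b x divides 1, so does its divisor `x`.
         (λ {x} {y} p≈xy → map₁ (∣ʳ-trans (const b , λ _ → refl))
           (split-∣1 f-irreducible {const b *ₚ x} {y} (λ i → trans (sym (bp≈f i))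
             (trans (sym (const-* b p i)) (trans (*ₚ-congˡ (const b) p (x *ₚ y) p≈xy i)
               (sym (*ₚ-assoc (const b) x y i)))))))
     , p∣f

  monic⇒hasDegree : ¬ 1# ≈ 0# → ∀ f {n} → MonicOfDegree f n → HasDegree f n
  monic⇒hasDegree 1≉0 f (fₙ≈1 , f≤n) = (λ fₙ≈0 → 1≉0 (trans (sym fₙ≈1) fₙ≈0)) , f≤n

  -- If h = g p, irreducibility of `h` makes `g` or `p` a unit. The irreducible `p` is not one, and
  -- a unit `g` has degree 0, which would force `h` and `p` to have the same degree.
  irreducible-∤ : ∀ h p {n d} → HasDegree h n → HasDegree p d → d < n →
                  Irreducible h → Irreducible p → ¬ p ∣ h
  irreducible-∤ h p {n} {d} hₙ p_d d<n h-irreducible p-irreducible (g , gp≈h)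
    with split-∣1 h-irreducible {g} {p} (λ i → sym (gp≈h i))
  ... | inj₂ p∣1 = p∤1 p-irreducible p∣1
  ... | inj₁ g∣1 =
    let a , b , gₐ , p_b , a+b≡n = hasDegree-factors g p h gp≈h hₙ
        n≡d = ≡.trans (≡.sym a+b≡n) (≡.cong₂ ℕ._+_ (∣1⇒degree≡0 g gₐ g∣1)
                (hasDegree-unique p p (λ _ → refl) p_b p_d))
    in ℕ.<-irrefl (≡.sym n≡d) d<n

  -- Only the coefficient at index 0 changes, and the positive degree puts the leading coefficient
  -- elsewhere.
  hasDegree-minus-1 : ∀ g {n} → HasDegree g n → 0 < n → HasDegree (g -ₚ const 1#) n
  hasDegree-minus-1 g {suc n} (gₙ≉0 , g≤n) _ =
    (λ eq → gₙ≉0 (trans (sym (same n)) eq)) ,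
    λ { (suc i) n<i → trans (same i) (g≤n (suc i) n<i) }
    where
    same : ∀ i → coeff (g -ₚ const 1#) (suc i) ≈ coeff g (suc i)
    same i = trans (coeff-+ g (-ₚ const 1#) (suc i)) (+-identityʳ _)

  monicIrreducibleFactor : ∀ f {n} → HasDegree f n → 0 < n →
                           ∃₂ λ p d → MonicOfDegree p d × Irreducible p × p ∣ f
  monicIrreducibleFactor f fₙ 0<n =
    let x , d , x_d , x-irreducible , x∣f = irreducibleFactor _ f fₙ 0<n
        p , p_d , p-irreducible , p∣x     = normalise x x_d x-irreducible
    in p , d , p_d , p-irreducible , ∣ʳ-trans p∣x x∣f

  -- Sums of powers of `g` modulo a factor of `g - 1`.

  open Congruence polyRing
  open RawSemiringDefs (RawRing.rawSemiring polyRawRing) using () renaming (_×_ to _×ₚ_)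

  -- Reconciles the `t`-fold sum of the polynomial 1, as produced by `∣sum-n`, with the constant
  -- polynomial in which the sum is taken inside the field. For `t` equal to 0 these are the
  -- different lists `[]` and `0# ∷ []`.
  ×ₚ1≈fromℕₚ : ∀ t → t ×ₚ const 1# ≈ₚ fromℕₚ t
  ×ₚ1≈fromℕₚ zero    i = sym (0∷[]≈[] i)
  ×ₚ1≈fromℕₚ (suc t) i = +ₚ-cong {const 1#} {const 1#} {t ×ₚ const 1#} {fromℕₚ t}
    (λ _ → refl) (×ₚ1≈fromℕₚ t) i

  sum-powers : ∀ p g {t} (m : Vector ℕ t) → p ∣ g -ₚ const 1# →
               p ∣ sumₚ (λ i → g ^ m i) -ₚ fromℕₚ t
  sum-powers p g {t} m p∣g-1 = ∣-respʳ
    (+ₚ-cong {S} {S} (λ _ → refl) (-ₚ-cong {t ×ₚ const 1#} {fromℕₚ t} (×ₚ1≈fromℕₚ t)))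
    (∣sum-n (λ i → g ^ m i) (λ i → ∣x-1⇒∣xᵐ-1 (m i) p∣g-1))
    where S = sumₚ (λ i → g ^ m i)

  unrepresentable : ∀ g {δ} → HasDegree g δ → 0 < δ → ∀ t →
    ∃₂ λ p d → MonicOfDegree p d × Irreducible p ×
      (∀ n → d < n → ∀ f h (m : Vector ℕ t) → f ≡ fromℕₚ t mod p →
        MonicOfDegree h n → Irreducible h → ¬ f ≈ₚ h +ₚ sumₚ (λ i → g ^ m i))
  unrepresentable g {δ} g_δ 0<δ t =
    -- Positive degree of `g` makes `g - 1` nonconstant, so it has an irreducible factor.
    avoid (monicIrreducibleFactor (g -ₚ const 1#) (hasDegree-minus-1 g g_δ 0<δ) 0<δ)
    where
    1≉0 : ¬ 1# ≈ 0#
    1≉0 = x≉0⇒1≉0 (proj₁ g_δ)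

    avoid : (∃₂ λ p d → MonicOfDegree p d × Irreducible p × p ∣ g -ₚ const 1#) → _
    avoid (p , d , p_d , p-irreducible , p∣g-1) =
      p , d , p_d , p-irreducible , λ n d<n f h m f≡t hₙ h-irreducible f≈h+S →
        irreducible-∤ h p (monic⇒hasDegree 1≉0 h hₙ) (monic⇒hasDegree 1≉0 p p_d) d<n
          h-irreducible p-irreducible
          (∣summand f h (sumₚ (λ i → g ^ m i)) (fromℕₚ t) f≈h+S f≡t (sum-powers p g m p∣g-1))

-- From a finite Heyting field to a finite field with inverses of all nonzero elements.

theorem1p4 : ∀ {c ℓ₁ ℓ₂} (q : ℕ) → PrimePower q →
    (F : HeytingField c ℓ₁ ℓ₂) → Inverse (HeytingField.setoid F) (setoid (Fin q)) →
    let open Polynomial (fieldRawRing F) in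
    (g : Poly) (δ : ℕ) → HasDegree g δ → 0 < δ →
    (t : ℕ) → 1 ≤ t →
    (r : Vector ℝ t) (r>0 : ∀ i → 0ℝ <ℝ r i) →
    ∃₂ λ (p : Poly) (d : ℕ) → MonicOfDegree p d × Irreducible p ×
    (∀ (n : ℕ) → d < n → (f : Poly) → MonicOfDegree f n → f ≡ fromℕₚ t mod p →
    ¬ 𝓡 g δ r r>0 n f)
theorem1p4 q _ F F↔Fin g δ g_δ 0<δ t _ r r>0 =
  let p , d , p_d , p-irreducible , avoids = unrepresentable g g_δ 0<δ t
  in p , d , p_d , p-irreducible , λ n d<n f _ f≡t R →
    let open 𝓡 R in
    avoids n d<n f h m f≡t h-monic h-irreducible representation
  where
  module F = HeytingField F
  R = HeytingCommutativeRing.commutativeRing F.heytingCommutativeRing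

  -- Tightness turns x ≉ 0 only into ¬ ¬ (x # 0), so the inverse of x is found by
  -- exhaustive search.
  inverse : ∀ x → ¬ x F.≈ F.0# → ∃[ y ] y F.* x F.≈ F.1#
  inverse x x≉0 = decidable-stable
    (any? (λ y≈z yx≈1 → F.trans (F.*-congʳ (F.sym y≈z)) yx≈1) (λ y → y F.* x ≟ F.1#))
    (λ ¬inverse → x≉0 (F.tight x F.0# .proj₁ (λ x#0 →
      let y , yx≈1 , _ = F.#⇒invertible x#0
      in ¬inverse (y , F.trans (F.*-congˡ (F.sym (x-0≈x x))) yx≈1))))
    where
    open FiniteSetoid F.setoid F↔Fin
    x-0≈x : ∀ x → x F.- F.0# F.≈ x
    x-0≈x x = F.trans (F.+-congˡ -0#≈0#) (F.+-identityʳ x)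
      where open RingProperties (CommutativeRing.ring R) using (-0#≈0#)

  open Polynomial (fieldRawRing F)
  open FiniteField R F↔Fin inverse
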